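{- The axiomatic system $\mathbf{KB}^\circ$ is sound and strongly complete with respect to the class of $\mathcal{TB}$-frames (reflexive and symmetric frames). That is, with $F$ the class of reflexive and symmetric frames: every theorem of $\mathbf{KB}^\circ$ is valid on $F$ (soundness), and for every set $\Gamma\cup\{\phi\}$ of $\mathcal{L}(\circ)$-formulas, if $\Gamma\vDash_F\phi$ then $\Gamma\vdash_{\mathbf{KB}^\circ}\phi$ (strong completeness).
   Context: Let $\mathbf{P}$ be a set of propositional variables, with $p,q\in\mathbf{P}$ distinct. The language $\mathcal{L}(\circ)$ is given by $\phi::=r\mid\neg\phi\mid(\phi\land\phi)\mid\circ\phi$ with $r\in\mathbf{P}$; other Boolean connectives and $\top$ are the usual abbreviations. A frame is $\langle S,R\rangle$ with $S$ a nonempty set and $R\subseteq S\times S$; it is reflexive (symmetric) if $R$ is. A model based on a frame is $\mathcal{M}=\langle S,R,V\rangle$ with $V:\mathbf{P}\to\mathcal{P}(S)$. Satisfaction: $\mathcal{M},s\vDash r$ iff $s\in V(r)$; Booleans as usual; $\mathcal{M},s\vDash\circ\phi$ iff ($\mathcal{M},s\vDash\phi$ implies that $\mathcal{M},t\vDash\phi$ for all $t$ with $sRt$). For a class $F$ of frames, $\phi$ is valid on $F$ if $\mathcal{M},s\vDash\phi$ for every model $\mathcal{M}$ based on a frame in $F$ and every $s$ in $\mathcal{M}$; $\Gamma\vDash_F\phi$ means: for every model $\mathcal{M}$ based on a frame in $F$ and every $s$ in $\mathcal{M}$, if $\mathcal{M},s\vDash\gamma$ for all $\gamma\in\Gamma$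 then $\mathcal{M},s\vDash\phi$. The system $\mathbf{K}^\circ$ has as axioms all propositional tautologies, $\circ\top$, $\neg p\to\circ p$, and $\circ p\land\circ q\to\circ(p\land q)$, and as inference rules uniform substitution, modus ponens, and the rule: from $\phi\to\psi$ infer $\circ\phi\land\phi\to\circ\psi$. The system $\mathbf{KB}^\circ$ is $\mathbf{K}^\circ$ plus the axiom $p\to\circ(\circ\neg p\to p)$. A derivation from $\Gamma$ to $\phi$ in a system, written $\Gamma\vdash\phi$ (with the system as subscript), is a finite sequence of $\mathcal{L}(\circ)$-formulas (ending in $\phi$) in which each formula is either an instantiation of an axiom, or an element of $\Gamma$, or the result of applying an inference rule to prior formulas in the sequence. A theorem is a formula $\phi$ for which there is a derivation from $\emptyset$ to $\phi$. -}

module Defs where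

open import Data.Bool.Base using (Bool; true; not; _∧_)
open import Data.List.Base using (List; []; _∷_)
open import Data.List.Membership.Propositional using (_∈_)
open import Data.Product.Base using (_×_; ∃-syntax)
open import Level using (Level; _⊔_; suc)
open import Relation.Binary.Core using (Rel)
open import Relation.Binary.Definitions using (Reflexive; Symmetric)
open import Relation.Binary.PropositionalEquality.Core using (_≡_)
open import Relation.Nullary.Negation.Core using (¬_)
open import Relation.Unary using (Pred)

infix  30 ∼_ ∘_
infixl 30 _[_]
infixr 25 _&_
infixr 20 _⊃_

data Form {ℓ : Level} (P : Set ℓ) : Set ℓ where
  var : P → Form P
  ∼_  : Form P → Form P
  _&_ : Form P → Form P → Form P
  ∘_  : Form P → Form P

_⊃_ : {ℓ : Level} {P : Set ℓ} → Form P → Form P → Form P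
φ ⊃ ψ = ∼ (φ & ∼ ψ)

-- The language has no primitive constants, so ⊤ is written with the help of a
-- variable.
⊤⟨_⟩ : {ℓ : Level} {P : Set ℓ} → P → Form P
⊤⟨ r ⟩ = ∼ (var r & ∼ var r)

_[_] : {ℓ : Level} {P : Set ℓ} → Form P → (P → Form P) → Form P
var r   [ σ ] = σ r
(∼ φ)   [ σ ] = ∼ (φ [ σ ])
(φ & ψ) [ σ ] = (φ [ σ ]) & (ψ [ σ ])
(∘ φ)   [ σ ] = ∘ (φ [ σ ])

record Frame (ℓ : Level) : Set (suc ℓ) where
  field
    S         : Set ℓ
    inhabited : S
    R         : Rel S ℓ

record Model {ℓ : Level} (P : Set ℓ) (𝓕 : Frame ℓ) : Set (suc ℓ) where
  open Frame 𝓕 public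
  field
    V : P → Pred S ℓ

infix 4 _,_⊨_

_,_⊨_ : {ℓ : Level} {P : Set ℓ} {𝓕 : Frame ℓ} →
        Model P 𝓕 → Frame.S 𝓕 → Form P → Set ℓ
M , s ⊨ var r = Model.V M r s
M , s ⊨ ∼ φ   = ¬ (M , s ⊨ φ)
M , s ⊨ φ & ψ = (M , s ⊨ φ) × (M , s ⊨ ψ)
M , s ⊨ ∘ φ   = M , s ⊨ φ → ∀ t → Model.R M s t → M , t ⊨ φ

FrameClass : (ℓ : Level) → Set (suc ℓ)
FrameClass ℓ = Pred (Frame ℓ) ℓ

TB : {ℓ : Level} → FrameClass ℓ
TB 𝓕 = Reflexive (Frame.R 𝓕) × Symmetric (Frame.R 𝓕)

ValidOn : {ℓ : Level} {P : Set ℓ} → FrameClass ℓ → Form P → Set (suc ℓ)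
ValidOn {ℓ} {P} F φ =
  (𝓕 : Frame ℓ) → F 𝓕 → (M : Model P 𝓕) (s : Frame.S 𝓕) → M , s ⊨ φ

infix 4 _⊨[_]_

_⊨[_]_ : {ℓ : Level} {P : Set ℓ} →
         Pred (Form P) ℓ → FrameClass ℓ → Form P → Set (suc ℓ)
_⊨[_]_ {ℓ} {P} Γ F φ =
  (𝓕 : Frame ℓ) → F 𝓕 → (M : Model P 𝓕) (s : Frame.S 𝓕) →
  (∀ γ → Γ γ → M , s ⊨ γ) → M , s ⊨ φ

-- Formulas ∘ φ count as propositional atoms, with truth values given by w.
-- (Restricting to ∘-free tautologies would lose some when P is finite.)
eval : {ℓ : Level} {P : Set ℓ} → (P → Bool) → (Form P → Bool) → Form P → Bool
eval v w (var r) = v r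
eval v w (∼ φ)   = not (eval v w φ)
eval v w (φ & ψ) = eval v w φ ∧ eval v w ψ
eval v w (∘ φ)   = w φ

Tautology : {ℓ : Level} {P : Set ℓ} → Pred (Form P) ℓ
Tautology φ = ∀ v w → eval v w φ ≡ true

data K° {ℓ : Level} {P : Set ℓ} (p q : P) : Pred (Form P) ℓ where
  taut : ∀ {φ} → Tautology φ → K° p q φ
  ∘⊤   : K° p q (∘ ⊤⟨ p ⟩)
  ∼⊃∘  : K° p q (∼ var p ⊃ ∘ var p)
  ∘&   : K° p q (∘ var p & ∘ var q ⊃ ∘ (var p & var q))

data KB° {ℓ : Level} {P : Set ℓ} (p q : P) : Pred (Form P) ℓ where
  k° : ∀ {φ} → K° p q φ → KB° p q φ
  b° : KB° p q (var p ⊃ ∘ (∘ ∼ var p ⊃ var p))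

-- What may be added to a sequence whose formulas so far are φs.  The inference
-- rules apply to arbitrary earlier formulas, including those that depend on Γ.
data Step {ℓ g : Level} {P : Set ℓ} (Ax : Pred (Form P) ℓ) (Γ : Pred (Form P) g)
          (φs : List (Form P)) : Pred (Form P) (ℓ ⊔ g) where
  axiom        : ∀ {φ} → Ax φ → (σ : P → Form P) → Step Ax Γ φs (φ [ σ ])
  premise      : ∀ {φ} → Γ φ → Step Ax Γ φs φ
  substitution : ∀ {φ} → φ ∈ φs → (σ : P → Form P) → Step Ax Γ φs (φ [ σ ])
  modusPonens  : ∀ {φ ψ} → φ ∈ φs → φ ⊃ ψ ∈ φs → Step Ax Γ φs ψ
  ∘-rule       : ∀ {φ ψ} → φ ⊃ ψ ∈ φs → Step Ax Γ φs (∘ φ & φ ⊃ ∘ ψ)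

-- Sequences are stored with the last formula at the head.
data Derivation {ℓ g : Level} {P : Set ℓ} (Ax : Pred (Form P) ℓ)
                (Γ : Pred (Form P) g) : Pred (List (Form P)) (ℓ ⊔ g) where
  []  : Derivation Ax Γ []
  _∷_ : ∀ {φ φs} → Step Ax Γ φs φ → Derivation Ax Γ φs → Derivation Ax Γ (φ ∷ φs)

infix 4 _⊢[_]_

_⊢[_]_ : {ℓ g : Level} {P : Set ℓ} →
         Pred (Form P) g → Pred (Form P) ℓ → Form P → Set (ℓ ⊔ g)
Γ ⊢[ Ax ] φ = ∃[ φs ] Derivation Ax Γ (φ ∷ φs)

{-# OPTIONS --safe #-}

-- For completeness, since premises may be substituted into, Γ ⊢ γ yields
-- Γ ⊢ γ [ σ ] where σ fixes the variables of φ and collapses all others to p.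
-- Hence it is enough to refute φ in a model of the formulas γ [ σ ], which live
-- in a countable fragment, so that Lindenbaum's lemma needs no choice principle
-- (and the failure of function extensionality does no harm).  The canonical
-- model relates s to t when t contains every ψ of the fragment for which both ψ
-- and ∘ ψ belong to s; axiom b° makes this relation symmetric.
module Submission where

open import Defs
open import Axiom.ExcludedMiddle using (ExcludedMiddle)
open import Data.Bool.Base using (Bool; true; false; not; _∧_; if_then_else_)
open import Data.Empty using (⊥-elim)
open import Data.List.Base
  using (List; []; _∷_; _++_; map; foldl; cartesianProductWith)
open import Data.List.Membership.Propositional using (_∈_)
open import Data.List.Membership.Propositional.Properties
  using (∈-++⁺ˡ; ∈-++⁺ʳ; ∈-map⁺; ∈-cartesianProductWith⁺)
open import Data.List.Relation.Unary.All as All using (All; []; _∷_)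
open import Data.List.Relation.Unary.Any using (here; there)
open import Data.Nat.Base using (ℕ; zero; suc; _≤′_; ≤′-reflexive; ≤′-step; _⊔_)
open import Data.Nat.Properties using (m≤m⊔n; m≤n⊔m; ≤⇒≤′)
open import Data.Product.Base using (_×_; _,_; ∃-syntax; proj₁; proj₂)
open import Data.Sum.Base using (_⊎_; inj₁; inj₂; [_,_]′)
open import Level using (Level; Lift; lift; lower)
open import Relation.Binary.PropositionalEquality.Core
  using (_≡_; _≢_; refl; sym; cong; cong₂; subst)
open import Relation.Nullary.Decidable.Core
  using (yes; no; does; proof; decidable-stable)
open import Relation.Nullary.Negation.Core using (¬_; contradiction)
open import Relation.Nullary.Reflects
  using (Reflects; invert; ¬-reflects; _×-reflects_)
open import Relation.Unary using (Pred; ∅)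

private
  variable
    ℓ g : Level
    P : Set ℓ
    φ ψ χ : Form P

-- Substitution and the countable fragment

variables : Form P → List P
variables (var r) = r ∷ []
variables (∼ φ)   = variables φ
variables (φ & ψ) = variables φ ++ variables ψ
variables (∘ φ)   = variables φ

subst-fix : (φ : Form P) {σ : P → Form P} →
            (∀ {r} → r ∈ variables φ → σ r ≡ var r) → φ [ σ ] ≡ φ
subst-fix (var r) fix = fix (here refl)
subst-fix (∼ φ)   fix = cong ∼_ (subst-fix φ fix)
subst-fix (φ & ψ) fix = cong₂ _&_ (subst-fix φ λ r → fix (∈-++⁺ˡ r))
                                  (subst-fix ψ λ r → fix (∈-++⁺ʳ (variables φ) r))
subst-fix (∘ φ)   fix = cong ∘_ (subst-fix φ fix)

module Fragment {ℓ} {P : Set ℓ} (rs : List P) where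

  -- Finite lists growing to all formulas over `rs`. Each keeps the previous one, so both operands
  -- of `_&_` can be brought to a common level.
  level  : ℕ → List (Form P)
  grow   : List (Form P) → List (Form P)
  grow φs = map ∼_ φs ++ map ∘_ φs ++ cartesianProductWith _&_ φs φs
  level zero    = map var rs
  level (suc n) = level n ++ grow (level n)

  level-mono : ∀ {m n} → m ≤′ n → φ ∈ level m → φ ∈ level n
  level-mono (≤′-reflexive refl) φ∈ = φ∈
  level-mono (≤′-step m≤n)       φ∈ = ∈-++⁺ˡ (level-mono m≤n φ∈)

  level-cover : (σ : P → Form P) → (∀ r → σ r ∈ map var rs) →
                ∀ φ → ∃[ n ] φ [ σ ] ∈ level n
  level-cover σ σ∈ (var r) = zero , σ∈ r
  level-cover σ σ∈ (∼ φ) =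
    let n , φ∈ = level-cover σ σ∈ φ
    in suc n , ∈-++⁺ʳ (level n) (∈-++⁺ˡ (∈-map⁺ ∼_ φ∈))
  level-cover σ σ∈ (φ & ψ) =
    let m , φ∈ = level-cover σ σ∈ φ
        n , ψ∈ = level-cover σ σ∈ ψ
        φ∈ = level-mono (≤⇒≤′ (m≤m⊔n m n)) φ∈
        ψ∈ = level-mono (≤⇒≤′ (m≤n⊔m m n)) ψ∈
        φs = level (m ⊔ n)
    in suc (m ⊔ n) ,
       ∈-++⁺ʳ φs (∈-++⁺ʳ (map ∼_ φs) (∈-++⁺ʳ (map ∘_ φs)
         (∈-cartesianProductWith⁺ _&_ φ∈ ψ∈)))
  level-cover σ σ∈ (∘ φ) =
    let n , φ∈ = level-cover σ σ∈ φ
    in suc n , ∈-++⁺ʳ (level n) (∈-++⁺ʳ (map ∼_ (level n)) (∈-++⁺ˡ (∈-map⁺ ∘_ φ∈)))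

-- Derivations

step-weaken : {Ax : Pred (Form P) ℓ} {Γ : Pred (Form P) g} {φs ψs : List (Form P)} →
              (∀ {χ} → χ ∈ φs → χ ∈ ψs) → Step Ax Γ φs φ → Step Ax Γ ψs φ
step-weaken inc (axiom ax σ)        = axiom ax σ
step-weaken inc (premise γ)         = premise γ
step-weaken inc (substitution φ∈ σ) = substitution (inc φ∈) σ
step-weaken inc (modusPonens φ∈ i∈) = modusPonens (inc φ∈) (inc i∈)
step-weaken inc (∘-rule i∈)         = ∘-rule (inc i∈)

derivation-++ : {Ax : Pred (Form P) ℓ} {Γ : Pred (Form P) g} {φs ψs : List (Form P)} →
                Derivation Ax Γ φs → Derivation Ax Γ ψs → Derivation Ax Γ (φs ++ ψs)
derivation-++ []      E = E
derivation-++ (s ∷ D) E = step-weaken ∈-++⁺ˡ s ∷ derivation-++ D E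

module _ {ℓ g} {P : Set ℓ} {Ax : Pred (Form P) ℓ} {Γ : Pred (Form P) g} where

  ⊢-mp : Γ ⊢[ Ax ] φ → Γ ⊢[ Ax ] φ ⊃ ψ → Γ ⊢[ Ax ] ψ
  ⊢-mp {φ} (φs , D) (ψs , E) =
    _ , modusPonens (here refl) (∈-++⁺ʳ (φ ∷ φs) (here refl)) ∷ derivation-++ D E

  ⊢-∘ : Γ ⊢[ Ax ] φ ⊃ ψ → Γ ⊢[ Ax ] ∘ φ & φ ⊃ ∘ ψ
  ⊢-∘ (_ , D) = _ , ∘-rule (here refl) ∷ D

  ⊢-axiom : Ax φ → (σ : P → Form P) → Γ ⊢[ Ax ] φ [ σ ]
  ⊢-axiom ax σ = _ , axiom ax σ ∷ []

  ⊢-premise : Γ φ → (σ : P → Form P) → Γ ⊢[ Ax ] φ [ σ ]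
  ⊢-premise γ σ = _ , substitution (here refl) σ ∷ premise γ ∷ []

-- Soundness

module Soundness {ℓ} (em : ExcludedMiddle ℓ) {P : Set ℓ} where

  module _ {𝓕 : Frame ℓ} (M : Model P 𝓕) where

    ⊃-elim : ∀ {s φ ψ} → M , s ⊨ φ ⊃ ψ → M , s ⊨ φ → M , s ⊨ ψ
    ⊃-elim h a = decidable-stable em λ ¬b → h (a , ¬b)

    ⊃-intro : ∀ {s φ ψ} → (M , s ⊨ φ → M , s ⊨ ψ) → M , s ⊨ φ ⊃ ψ
    ⊃-intro f (a , ¬b) = ¬b (f a)

    -- With excluded middle, truth at `s` is a Boolean valuation that treats the formulas `∘ ψ` as
    -- atoms, as `Tautology` does.
    eval-reflects : ∀ s φ → Reflects (M , s ⊨ φ)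
      (eval (λ r → does (em {M , s ⊨ var r})) (λ ψ → does (em {M , s ⊨ ∘ ψ})) φ)
    eval-reflects s (var r) = proof em
    eval-reflects s (∼ φ)   = ¬-reflects (eval-reflects s φ)
    eval-reflects s (φ & ψ) = eval-reflects s φ ×-reflects eval-reflects s ψ
    eval-reflects s (∘ φ)   = proof em

    tautology-sound : ∀ s → Tautology φ → M , s ⊨ φ
    tautology-sound {φ} s t =
      invert (subst (Reflects (M , s ⊨ φ)) (t _ _) (eval-reflects s φ))

    pullback : (P → Form P) → Model P 𝓕
    pullback σ = record { V = λ r s → M , s ⊨ σ r }

    module _ (σ : P → Form P) where

      -- Negation and the antecedent in the truth condition of `∘` reverse the direction, hence the
      -- mutual recursion.
      subst-from : ∀ φ {s} → M , s ⊨ φ [ σ ] → pullback σ , s ⊨ φ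
      subst-to   : ∀ φ {s} → pullback σ , s ⊨ φ → M , s ⊨ φ [ σ ]

      subst-from (var r) h         = h
      subst-from (∼ φ)   h a       = h (subst-to φ a)
      subst-from (φ & ψ) (h , h′)  = subst-from φ h , subst-from ψ h′
      subst-from (∘ φ)   h a t sRt = subst-from φ (h (subst-to φ a) t sRt)

      subst-to (var r) h         = h
      subst-to (∼ φ)   h a       = h (subst-from φ a)
      subst-to (φ & ψ) (h , h′)  = subst-to φ h , subst-to ψ h′
      subst-to (∘ φ)   h a t sRt = subst-to φ (h (subst-from φ a) t sRt)

  module _ {p q : P} where

    axiom-valid : KB° p q φ → ValidOn TB φ
    axiom-valid {φ} (k° (taut t)) 𝓕 _ M s = tautology-sound M {φ} s t
    axiom-valid (k° ∘⊤)       𝓕 _ M s = λ _ _ _ (a , ¬a) → ¬a a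
    axiom-valid (k° ∼⊃∘)      𝓕 _ M s =
      ⊃-intro M {φ = ∼ var p} {∘ var p} λ ¬a a → contradiction a ¬a
    axiom-valid (k° ∘&)       𝓕 _ M s =
      ⊃-intro M {φ = ∘ var p & ∘ var q} {∘ (var p & var q)}
        λ (f , h) (a , b) t sRt → f a t sRt , h b t sRt
    axiom-valid b° 𝓕 (_ , symm) M s =
      ⊃-intro M {φ = var p} {∘ (∘ ∼ var p ⊃ var p)} λ a _ t sRt →
        ⊃-intro M {φ = ∘ ∼ var p} {var p} λ f →
          -- Were `p` false at `t`, then `∘ ∼ var p` would make it false at `s`, which `t` sees by
          -- symmetry.
          decidable-stable em λ ¬b → f ¬b s (symm sRt) a

    -- Substitution and the ∘-rule preserve validity but not truth at a state, so the induction
    -- carries validity.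
    step-valid : ∀ {φs} → All (ValidOn TB) φs → Step (KB° p q) ∅ φs φ →
                 ValidOn TB φ
    step-valid vs (axiom {φ} ax σ) 𝓕 F M s =
      subst-to M σ φ (axiom-valid ax 𝓕 F (pullback M σ) s)
    step-valid vs (premise ())
    step-valid vs (substitution {φ} φ∈ σ) 𝓕 F M s =
      subst-to M σ φ (All.lookup vs φ∈ 𝓕 F (pullback M σ) s)
    step-valid vs (modusPonens {φ} {ψ} φ∈ i∈) 𝓕 F M s =
      ⊃-elim M {φ = φ} {ψ} (All.lookup vs i∈ 𝓕 F M s) (All.lookup vs φ∈ 𝓕 F M s)
    step-valid vs (∘-rule {φ} {ψ} i∈) 𝓕 F M s =
      ⊃-intro M {φ = ∘ φ & φ} {∘ ψ} λ (f , a) _ t sRt →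
        ⊃-elim M {φ = φ} {ψ} (All.lookup vs i∈ 𝓕 F M t) (f a t sRt)

    derivation-valid : ∀ {φs} → Derivation (KB° p q) ∅ φs →
                       All (ValidOn TB) φs
    derivation-valid []      = []
    derivation-valid (s ∷ D) = let vs = derivation-valid D in step-valid vs s ∷ vs

-- Completeness

-- A record, so that φ can be inferred from Holds v w φ (it cannot be inferred
-- from eval v w φ ≡ true, which computes).
record Holds {ℓ} {P : Set ℓ} (v : P → Bool) (w : Form P → Bool) (φ : Form P) : Set where
  constructor holds
  field
    evaluates : eval v w φ ≡ true

open Holds

module _ {ℓ} {P : Set ℓ} {v : P → Bool} {w : Form P → Bool} where

  private
    H : Form P → Set
    H = Holds v w

  &-elim : H (φ & ψ) → H φ × H ψ
  &-elim {φ} {ψ} (holds e) with eval v w φ in a | eval v w ψ in b | e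
  ... | true | true | _ = holds a , holds b

  &-intro : H φ → H ψ → H (φ & ψ)
  &-intro (holds a) (holds b) = holds (cong₂ _∧_ a b)

  ∼-elim : H (∼ φ) → ¬ H φ
  ∼-elim {φ} (holds e) (holds a) with eval v w φ | e | a
  ... | true | () | _

  ∼-intro : ¬ H φ → H (∼ φ)
  ∼-intro {φ} ¬a with eval v w φ in e
  ... | true  = contradiction (holds e) ¬a
  ... | false = holds (cong not e)

  by-cases : ∀ φ → (H φ → H ψ) → (H (∼ φ) → H ψ) → H ψ
  by-cases φ f g with eval v w φ in e
  ... | true  = f (holds e)
  ... | false = g (holds (cong not e))

  ⊃-elim : H (φ ⊃ ψ) → H φ → H ψ
  ⊃-elim {φ} {ψ} i a =
    by-cases ψ (λ b → b) λ ¬b → ⊥-elim (∼-elim i (&-intro a ¬b))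

  ⊃-intro : (H φ → H ψ) → H (φ ⊃ ψ)
  ⊃-intro f = ∼-intro λ c → let a , ¬b = &-elim c in ∼-elim ¬b (f a)

-- All instances of the axioms are included, so that closure under substitution
-- is not needed.
record IsLogic {ℓ} {P : Set ℓ} (p : P) (L : Pred (Form P) ℓ) : Set ℓ where
  field
    tautology : Tautology φ → L φ
    mp        : L φ → L (φ ⊃ ψ) → L ψ
    mono      : L (φ ⊃ ψ) → L (∘ φ & φ ⊃ ∘ ψ)
    ∘-⊤       : L (∘ ⊤⟨ p ⟩)
    ∼-⊃-∘     : ∀ φ → L (∼ φ ⊃ ∘ φ)
    ∘-&       : ∀ φ ψ → L (∘ φ & ∘ ψ ⊃ ∘ (φ & ψ))
    brouwer   : ∀ φ → L (φ ⊃ ∘ (∘ ∼ φ ⊃ φ))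

module Canonical {ℓ} (em : ExcludedMiddle ℓ) {P : Set ℓ} {p : P}
                 {L : Pred (Form P) ℓ} (isLogic : IsLogic p L)
                 (σ : P → Form P) (level : ℕ → List (Form P))
                 (cover : ∀ φ → ∃[ n ] φ [ σ ] ∈ level n) where

  private module L = IsLogic isLogic

  record IsTheory {u} (U : Pred (Form P) u) : Set (ℓ Level.⊔ u) where
    field
      extends : L φ → U φ
      mp      : U φ → U (φ ⊃ ψ) → U ψ

    -- Propositional steps are checked on valuations and enter the theory through the tautology
    -- axioms, which replaces Hilbert-style derivations.
    rule₀ : (∀ v w → Holds v w φ) → U φ
    rule₀ f = extends (L.tautology λ v w → evaluates (f v w))

    rule₁ : U φ → (∀ v w → Holds v w φ → Holds v w ψ) → U ψ
    rule₁ a f = mp a (rule₀ λ v w → ⊃-intro (f v w))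

    rule₂ : U φ → U ψ →
            (∀ v w → Holds v w φ → Holds v w ψ → Holds v w χ) → U χ
    rule₂ a b f = mp b (rule₁ a λ v w a → ⊃-intro (f v w a))

  L-isTheory : IsTheory L
  L-isTheory = record { extends = λ a → a ; mp = L.mp }

  -- Membership is Boolean so that states form a type in `Set ℓ` and can be the points of a
  -- `Frame ℓ`. Completeness is asked of the instances under `σ` only, as these are what the levels
  -- cover.
  record State : Set ℓ where
    field
      member     : Form P → Bool

    Mem : Form P → Set
    Mem φ = member φ ≡ true

    field
      isTheory   : IsTheory Mem
      consistent : Mem φ → ¬ Mem (∼ φ)
      complete   : ∀ φ → Mem (φ [ σ ]) ⊎ Mem (∼ (φ [ σ ]))

    open IsTheory isTheory public

    refute : ∀ φ → ¬ Mem (φ [ σ ]) → Mem (∼ (φ [ σ ]))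
    refute φ ¬φ = [ (λ a → contradiction a ¬φ) , (λ a → a) ]′ (complete φ)

  -- Lindenbaum's lemma

  module Lindenbaum {U : Pred (Form P) ℓ} (isTheory : IsTheory U)
                    (θ : Form P) (¬θ : ¬ U θ) where

    open IsTheory isTheory

    ⊃-refl : U (φ ⊃ φ)
    ⊃-refl = rule₀ λ v w → ⊃-intro λ a → a

    ⊃-trans : U (φ ⊃ ψ) → U (ψ ⊃ χ) → U (φ ⊃ χ)
    ⊃-trans i j = rule₂ i j λ v w i j → ⊃-intro λ a → ⊃-elim j (⊃-elim i a)

    -- α is the conjunction of the formulas added to U so far.
    add : Form P → Form P → Form P
    add α ψ = if does (em {U (α & ψ ⊃ θ)}) then α else α & ψ

    add-⊃ : ∀ α ψ → U (add α ψ ⊃ α)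
    add-⊃ α ψ with em {U (α & ψ ⊃ θ)}
    ... | yes _ = ⊃-refl
    ... | no  _ = rule₀ λ v w → ⊃-intro λ a → proj₁ (&-elim a)

    add-avoids : ∀ α ψ → ¬ U (α ⊃ θ) → ¬ U (add α ψ ⊃ θ)
    add-avoids α ψ ¬i with em {U (α & ψ ⊃ θ)}
    ... | yes _ = ¬i
    ... | no ¬j = ¬j

    -- A rejected `ψ` is only known to lead to `θ`; `limit-complete` turns this into a negation.
    Decided : Form P → Form P → Set ℓ
    Decided α ψ = U (α ⊃ ψ) ⊎ U (α ⊃ (ψ ⊃ θ))

    add-decides : ∀ α ψ → Decided (add α ψ) ψ
    add-decides α ψ with em {U (α & ψ ⊃ θ)}
    ... | yes i = inj₂ (rule₁ i λ v w i → ⊃-intro λ a → ⊃-intro λ b → ⊃-elim i (&-intro a b))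
    ... | no  _ = inj₁ (rule₀ λ v w → ⊃-intro λ a → proj₂ (&-elim a))

    decided-mono : ∀ {α β} → U (β ⊃ α) → Decided α ψ → Decided β ψ
    decided-mono i (inj₁ j) = inj₁ (⊃-trans i j)
    decided-mono i (inj₂ j) = inj₂ (⊃-trans i j)

    adds-⊃ : ∀ α ψs → U (foldl add α ψs ⊃ α)
    adds-⊃ α []       = ⊃-refl
    adds-⊃ α (ψ ∷ ψs) = ⊃-trans (adds-⊃ (add α ψ) ψs) (add-⊃ α ψ)

    adds-avoids : ∀ α ψs → ¬ U (α ⊃ θ) → ¬ U (foldl add α ψs ⊃ θ)
    adds-avoids α []       ¬i = ¬i
    adds-avoids α (ψ ∷ ψs) ¬i = adds-avoids (add α ψ) ψs (add-avoids α ψ ¬i)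

    adds-decides : ∀ α ψs → ψ ∈ ψs → Decided (foldl add α ψs) ψ
    adds-decides α (ψ ∷ ψs) (here refl) =
      decided-mono (adds-⊃ (add α ψ) ψs) (add-decides α ψ)
    adds-decides α (ψ ∷ ψs) (there ψ∈)  = adds-decides (add α ψ) ψs ψ∈

    stage : ℕ → Form P
    stage zero    = ⊤⟨ p ⟩
    stage (suc n) = foldl add (stage n) (level n)

    stage-avoids : ∀ n → ¬ U (stage n ⊃ θ)
    stage-avoids zero    i = ¬θ (rule₁ i λ v w i → ⊃-elim i (⊃-intro λ a → a))
    stage-avoids (suc n)   = adds-avoids (stage n) (level n) (stage-avoids n)

    stage-mono : ∀ {m n} → m ≤′ n → U (stage n ⊃ stage m)
    stage-mono (≤′-reflexive refl)     = ⊃-refl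
    stage-mono (≤′-step {n = n} m≤n) =
      ⊃-trans (adds-⊃ (stage n) (level n)) (stage-mono m≤n)

    -- The union of the theories that the stages generate over `U`. It also contains formulas
    -- outside the fragment, so it is closed under modus ponens.
    Limit : Pred (Form P) ℓ
    Limit φ = ∃[ n ] U (stage n ⊃ φ)

    limit₂ : Limit φ → Limit ψ → ∃[ n ] U (stage n ⊃ φ) × U (stage n ⊃ ψ)
    limit₂ (m , i) (n , j) =
      m ⊔ n , ⊃-trans (stage-mono (≤⇒≤′ (m≤m⊔n m n))) i
            , ⊃-trans (stage-mono (≤⇒≤′ (m≤n⊔m m n))) j

    limit-mp : Limit φ → Limit (φ ⊃ ψ) → Limit ψ
    limit-mp a b =
      let n , i , j = limit₂ a b
      in n , rule₂ i j λ v w i j → ⊃-intro λ c → ⊃-elim (⊃-elim j c) (⊃-elim i c)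

    limit-avoids : ¬ Limit θ
    limit-avoids (n , i) = stage-avoids n i

    limit-extends : U φ → Limit φ
    limit-extends a = zero , rule₁ a λ v w a → ⊃-intro λ _ → a

    limit-isTheory : IsTheory Limit
    limit-isTheory = record
      { extends = λ a → limit-extends (extends a) ; mp = limit-mp }

    limit-decides : ∀ φ → Limit (φ [ σ ]) ⊎ Limit (φ [ σ ] ⊃ θ)
    limit-decides φ with cover φ
    ... | n , φ∈ with adds-decides (stage n) (level n) φ∈
    -- The formulas of `level n` are processed on the way from `stage n` to `stage (suc n)`.
    ... | inj₁ i = inj₁ (suc n , i)
    ... | inj₂ i = inj₂ (suc n , i)

    limit-complete : ∀ φ → Limit (φ [ σ ]) ⊎ Limit (∼ (φ [ σ ]))
    limit-complete φ with limit-decides φ | limit-decides (∼ φ)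
    ... | inj₁ a | _      = inj₁ a
    ... | _      | inj₁ b = inj₂ b
    -- If `φ [ σ ]` and its negation both led to `θ`, then `θ` would follow outright.
    ... | inj₂ i | inj₂ j = contradiction
      (IsTheory.rule₂ limit-isTheory i j λ v w i j → by-cases _ (⊃-elim i) (⊃-elim j))
      limit-avoids

    limit-consistent : Limit φ → ¬ Limit (∼ φ)
    limit-consistent a b = limit-avoids
      (IsTheory.rule₂ limit-isTheory a b λ v w a b → ⊥-elim (∼-elim b a))

    to : does (em {Limit φ}) ≡ true → Limit φ
    to {φ} e with em {Limit φ}
    ... | yes a = a

    from : Limit φ → does (em {Limit φ}) ≡ true
    from {φ} a with em {Limit φ}
    ... | yes _ = refl
    ... | no ¬a = contradiction a ¬a

    state : State
    state = record
      { member     = λ φ → does (em {Limit φ})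
      ; isTheory   = record
        { extends = λ a → from (IsTheory.extends limit-isTheory a)
        ; mp      = λ a b → from (limit-mp (to a) (to b)) }
      ; consistent = λ a b → limit-consistent (to a) (to b)
      ; complete   = λ φ → [ (λ a → inj₁ (from a)) , (λ b → inj₂ (from b)) ]′
                             (limit-complete φ)
      }

    state-extends : U φ → State.Mem state φ
    state-extends a = from (limit-extends a)

    state-avoids : ¬ State.Mem state θ
    state-avoids a = limit-avoids (to a)

  -- The canonical frame and model

  open State using (Mem)

  R : State → State → Set ℓ
  R s t = ∀ φ → Mem s (∘ (φ [ σ ])) → Mem s (φ [ σ ]) → Mem t (φ [ σ ])

  -- Let `t` contain `φ` and `∘ φ` while `s` contains `∼ φ`. Brouwer's axiom for `∼ φ` puts `∘ β`
  -- into `s`, and `β` itself follows from `∼ φ`, so `β` passes to `t`. By the ∘-rule `t` also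
  -- contains `∘ ∼ ∼ φ`, the antecedent of `β`, and hence `∼ φ`, which is inconsistent.
  R-sym : ∀ {s t} → R s t → R t s
  R-sym {s} {t} sRt φ ∘φ∈t φ∈t with State.complete s φ
  ... | inj₁ φ∈s  = φ∈s
  ... | inj₂ ¬φ∈s = ⊥-elim (t.consistent φ∈t ¬φ∈t)
    where
    module s = State s
    module t = State t
    φ′ = φ [ σ ]
    β = ∘ ∼ ∼ φ ⊃ ∼ φ
    β∈s : Mem s (β [ σ ])
    β∈s = s.rule₁ ¬φ∈s λ v w a → ⊃-intro λ _ → a
    β∈t : Mem t (β [ σ ])
    β∈t = sRt β (s.mp ¬φ∈s (s.extends (L.brouwer (∼ φ′)))) β∈s
    ∘¬¬φ∈t : Mem t (∘ ∼ ∼ φ′)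
    ∘¬¬φ∈t = t.mp (t.rule₂ ∘φ∈t φ∈t λ v w → &-intro)
                  (t.extends (L.mono (IsTheory.rule₀ L-isTheory λ v w →
                    ⊃-intro λ a → ∼-intro λ ¬a → ∼-elim ¬a a)))
    ¬φ∈t : Mem t (∼ φ′)
    ¬φ∈t = t.mp ∘¬¬φ∈t β∈t

  frame : State → Frame ℓ
  frame s = record { S = State ; inhabited = s ; R = R }

  frame-TB : ∀ s → TB (frame s)
  -- Reflexivity is immediate because `R` assumes `φ` in `s` besides `∘ φ`.
  frame-TB s = (λ _ _ a → a) , λ {t} {u} → R-sym {t} {u}

  model : ∀ s → Model P (frame s)
  model s = record { V = λ r t → Lift ℓ (Mem t (σ r)) }

  -- Existence of successor states

  module _ (s : State) where

    private module s = State s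

    -- By ∘& a single δ stands for finitely many formulas ψ with ψ and ∘ ψ in s.
    Successor : Pred (Form P) ℓ
    Successor ψ = ∃[ δ ] Mem s (∘ δ) × Mem s δ × L (δ ⊃ ψ)

    successor-isTheory : IsTheory Successor
    successor-isTheory = record
      { extends = λ a → ⊤⟨ p ⟩ , s.extends L.∘-⊤ , s.rule₀ (λ v w → ⊃-intro λ b → b)
                       , IsTheory.rule₁ L-isTheory a λ v w a → ⊃-intro λ _ → a
      ; mp = λ (δ , ∘δ , d , i) (ε , ∘ε , e , j) →
          δ & ε
        , s.mp (s.rule₂ ∘δ ∘ε λ v w → &-intro) (s.extends (L.∘-& δ ε))
        , s.rule₂ d e (λ v w → &-intro)
        , IsTheory.rule₂ L-isTheory i j λ v w i j → ⊃-intro λ c →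
            let a , b = &-elim c in ⊃-elim (⊃-elim j b) (⊃-elim i a)
      }

    -- The ∘-rule for `δ ⊃ φ` yields `∘ φ` from `∘ δ` together with `δ`, which is why `Successor`
    -- records both.
    successor-∘ : Successor φ → Mem s (∘ φ)
    successor-∘ (δ , ∘δ , d , i) =
      s.mp (s.rule₂ ∘δ d λ v w → &-intro) (s.extends (L.mono i))

    -- If `∘ φ` is missing from `s`, then `Successor` omits `φ` by `successor-∘`. A state that
    -- extends `Successor` and avoids `φ` is related to `s`.
    witness : ∀ φ → ¬ Mem s (∘ φ) → ∃[ t ] R s t × ¬ Mem t φ
    witness φ ¬∘φ = state , sRt , state-avoids
      where
      open Lindenbaum successor-isTheory φ (λ u → ¬∘φ (successor-∘ u))
      sRt : R s state
      sRt ψ ∘ψ a = state-extends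
        (ψ [ σ ] , ∘ψ , a , IsTheory.rule₀ L-isTheory λ v w → ⊃-intro λ b → b)

  -- The truth lemma

  module _ {s₀ : State} where

    truth-to   : ∀ φ s → model s₀ , s ⊨ φ → Mem s (φ [ σ ])
    truth-from : ∀ φ s → Mem s (φ [ σ ]) → model s₀ , s ⊨ φ

    truth-to (var r) s h = lower h
    truth-to (∼ φ)   s h = State.refute s φ λ a → h (truth-from φ s a)
    truth-to (φ & ψ) s (h , h′) =
      State.rule₂ s (truth-to φ s h) (truth-to ψ s h′) λ v w → &-intro
    truth-to (∘ φ)   s h with State.complete s (∘ φ) | State.complete s φ
    ... | inj₁ a   | _        = a
    -- Where `φ` fails, `∘ φ` is vacuously true; the axiom `∼ φ ⊃ ∘ φ` mirrors this.
    ... | inj₂ _   | inj₂ ¬φ  = State.mp s ¬φ (State.extends s (L.∼-⊃-∘ (φ [ σ ])))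
    ... | inj₂ ¬∘φ | inj₁ a   =
      let t , sRt , ¬φ = witness s (φ [ σ ]) λ b → State.consistent s b ¬∘φ
      in contradiction (truth-to φ t (h (truth-from φ s a) t sRt)) ¬φ

    truth-from (var r) s a = lift a
    truth-from (∼ φ)   s a h = State.consistent s (truth-to φ s h) a
    truth-from (φ & ψ) s a =
        truth-from φ s (State.rule₁ s a λ v w c → proj₁ (&-elim c))
      , truth-from ψ s (State.rule₁ s a λ v w c → proj₂ (&-elim c))
    truth-from (∘ φ)   s a h t sRt = truth-from φ t (sRt φ a (truth-to φ s h))

-- Axiom instances and strong completeness

module Completeness {ℓ} (em : ExcludedMiddle ℓ) {P : Set ℓ} {p q : P} (p≢q : p ≢ q) where

  -- Substitutes for `p` and `q` simultaneously, as general instances of `∘&` require; this works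
  -- because `p` and `q` are distinct.
  pair : Form P → Form P → P → Form P
  pair φ ψ r = if does (em {r ≡ p}) then φ else ψ

  pair-p : ∀ φ ψ → pair φ ψ p ≡ φ
  pair-p φ ψ with em {p ≡ p}
  ... | yes _  = refl
  ... | no p≢p = contradiction refl p≢p

  pair-q : ∀ φ ψ → pair φ ψ q ≡ ψ
  pair-q φ ψ with em {q ≡ p}
  ... | yes q≡p = contradiction (sym q≡p) p≢q
  ... | no _    = refl

  ⊢-isLogic : (Γ : Pred (Form P) ℓ) → IsLogic p (Γ ⊢[ KB° p q ]_)
  ⊢-isLogic Γ = record
    { tautology = λ {φ} t → subst (Γ ⊢[ KB° p q ]_) (subst-fix φ λ _ → refl)
                              (⊢-axiom (k° (taut {φ = φ} t)) var)
    ; mp        = ⊢-mp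
    ; mono      = ⊢-∘
    ; ∘-⊤       = ⊢-axiom (k° ∘⊤) var
    ; ∼-⊃-∘     = λ φ → ⊢-axiom (k° ∼⊃∘) λ _ → φ
    ; ∘-&       = λ φ ψ → subst (Γ ⊢[ KB° p q ]_)
                    (cong₂ (λ a b → ∘ a & ∘ b ⊃ ∘ (a & b)) (pair-p φ ψ) (pair-q φ ψ))
                    (⊢-axiom (k° ∘&) (pair φ ψ))
    ; brouwer   = λ φ → ⊢-axiom b° λ _ → φ
    }

  module _ (φ : Form P) where

    collapse : P → Form P
    collapse r = if does (em {r ∈ variables φ}) then var r else var p

    collapse-fix : ∀ {r} → r ∈ variables φ → collapse r ≡ var r
    collapse-fix {r} r∈ with em {r ∈ variables φ}
    ... | yes _ = refl
    ... | no r∉ = contradiction r∈ r∉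

    collapse-∈ : ∀ r → collapse r ∈ map var (p ∷ variables φ)
    collapse-∈ r with em {r ∈ variables φ}
    ... | yes r∈ = there (∈-map⁺ var r∈)
    ... | no _   = here refl

  -- The logic of the canonical model is the set of all formulas derivable from `Γ`; it is closed
  -- under the ∘-rule because derivations may apply that rule to premises.
  complete : (Γ : Pred (Form P) ℓ) (φ : Form P) → Γ ⊨[ TB ] φ → Γ ⊢[ KB° p q ] φ
  complete Γ φ Γ⊨φ = decidable-stable em λ Γ⊬φ →
    let open Lindenbaum L-isTheory φ Γ⊬φ
        φ-true = Γ⊨φ (frame state) (frame-TB state) (model state) state λ γ γ∈Γ →
          truth-from γ state (state-extends (⊢-premise γ∈Γ (collapse φ)))
    -- Since `collapse φ` fixes the variables of `φ`, the truth lemma puts `φ` itself into a state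
    -- built to avoid it.
    in state-avoids (subst (State.Mem state) (subst-fix φ (collapse-fix φ))
         (truth-to φ state φ-true))
    where
    open Fragment (p ∷ variables φ)
    open Canonical em (⊢-isLogic Γ) (collapse φ) level
      (level-cover (collapse φ) (collapse-∈ φ))

theorem41 : ∀ {ℓ} → ExcludedMiddle ℓ →
    (P : Set ℓ) (p q : P) → p ≢ q →
    ((φ : Form P) → ∅ ⊢[ KB° p q ] φ → ValidOn TB φ) ×
    ((Γ : Pred (Form P) ℓ) (φ : Form P) → Γ ⊨[ TB ] φ → Γ ⊢[ KB° p q ] φ)
theorem41 em P p q p≢q =
    (λ φ (_ , D) → All.head (Soundness.derivation-valid em D))
  , Completeness.complete em p≢q
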